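{- Let $(X,d)$ be a finite metric space and let $k\ge 1$ be an integer. For any $k$-barely fractional strategy for metrical task systems on $(X,d)$, there is a $k$-barely random algorithm for metrical task systems on $(X,d)$ that achieves the same cost. Reciprocally, for any $k$-barely random algorithm for metrical task systems on $(X,d)$, there is a $k$-barely fractional strategy for metrical task systems on $(X,d)$ that achieves the same cost.
   Context: A cost sequence is $c=(c(t))_{t\ge 1}$ with $c(t)\in\mathbb{R}_+^X$. A $k$-barely random algorithm for metrical task systems is a map $\mathcal{A}$ which, with one seed $s$ drawn uniformly from $\{1,\dots,k\}$, outputs the states $\rho_{\mathcal A}(t)=\mathcal{A}(c(1),\dots,c(t),s)\in X$ for all $t\ge 0$. The cost of a sequence of states $\rho=(\rho(t))_{t\ge 0}$ is $\mathrm{Cost}(\rho,c)=\sum_{t\ge 1}\big(d(\rho(t-1),\rho(t))+c_{\rho(t)}(t)\big)$, and the cost of the algorithm $\mathcal{A}$ on $c$ is the expected cost $\mathbb{E}_{s}[\mathrm{Cost}(\rho_{\mathcal A},c)]$. $\mathcal{P}(X)$ is the set of probability distributions on $X$, and $\mathcal{P}_k(X)$ is the set of those taking values in $\{0,1/k,2/k,\dots,1\}$. For $x,x'\in\mathcal{P}(X)$, $\mathrm{OT}(x,x')=\inf_{\pi}\sum_{\rho,\rho'}\pi(\rho,\rho')d(\rho,\rho')$, where $\pi$ ranges over couplings of $x$ and $x'$ (probability distributions on $X\times X$ with marginals $x$ and $x'$). A $k$-barely fractional strategy $x(\cdot)$ assigns, for every $t\ge 0$, a distribution $x(t)=x(c(1),\dots,c(t))\in\mathcal{P}_k(X)$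 depending (deterministically) only on $c(1),\dots,c(t)$. Its cost on $c$ is $\mathrm{Cost}(x(\cdot),c)=\sum_{t\ge 1}\big(\mathrm{OT}(x(t-1),x(t))+\sum_{\rho\in X}x_\rho(t)c_\rho(t)\big)$.
   Formalization: In the reciprocal direction "achieves the same cost" is stated as "achieves at most the same cost" on every cost sequence, since exact equality fails when the random algorithm's seeds move wastefully, e.g. two seeds exchanging positions. -}

module Defs where

open import Algebra.Bundles using (CommutativeRing)
open import Algebra.Structures using (IsCommutativeRing)
open import Axiom.ExcludedMiddle using (ExcludedMiddle)
open import Data.Fin.Base using (Fin; zero; suc; toℕ)
open import Data.List.Base using (List; applyUpTo)
open import Data.Nat.Base as ℕ using (ℕ; zero; suc)
open import Data.Product.Base using (Σ-syntax; ∃; ∃-syntax; _×_; _,_; proj₁; proj₂)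
open import Data.Refinement using (Refinement-syntax; value)
import Data.Vec.Functional as Vector
open import Function.Base using (_∘_)
open import Function.Bundles using (_↔_; Inverse)
open import Function.Metric.Structures using (IsGeneralMetric)
open import Level using (0ℓ)
import Relation.Binary.Construct.Add.Supremum.NonStrict as AddSupremum
open import Relation.Binary.PropositionalEquality
  using (_≡_; _≢_; refl; sym; trans; cong; subst; subst₂; module ≡-Reasoning)
open import Relation.Binary.Structures using (IsTotalOrder)
open import Relation.Nullary.Construct.Add.Supremum using (_⁺; [_]; ⊤⁺)
open import Relation.Nullary.Decidable.Core using (Dec; yes; no)
import Algebra.Properties.Semiring.Mult as Mult
import Algebra.Properties.Semiring.Sum as Sum
import Algebra.Properties.Ring as RingProperties

module Bounds {A : Set} (_≤_ : A → A → Set) where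

  UpperBound LowerBound IsSupremum IsInfimum : (A → Set) → A → Set
  UpperBound P b = ∀ {x} → P x → x ≤ b
  LowerBound P b = ∀ {x} → P x → b ≤ x
  IsSupremum P s = UpperBound P s × (∀ {b} → UpperBound P b → s ≤ b)
  IsInfimum  P i = LowerBound P i × (∀ {b} → LowerBound P b → b ≤ i)

-- The real numbers, characterised (classically, up to unique isomorphism) as
-- a Dedekind-complete totally ordered field.

record Reals : Set₁ where
  infix  8 _⁻¹
  infix  8 -_
  infixl 7 _*_
  infixl 6 _+_
  infix  4 _≤_
  field
    ℝ        : Set
    _+_ _*_  : ℝ → ℝ → ℝ
    -_       : ℝ → ℝ
    0# 1#    : ℝ
    _≤_      : ℝ → ℝ → Set
    -- Total, but unconstrained at 0#.
    _⁻¹      : ℝ → ℝ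

    isCommutativeRing : IsCommutativeRing _≡_ _+_ _*_ -_ 0# 1#
    0≢1               : 0# ≢ 1#
    *-inverseʳ        : ∀ x → x ≢ 0# → x * x ⁻¹ ≡ 1#
    isTotalOrder      : IsTotalOrder _≡_ _≤_
    +-monoʳ-≤         : ∀ x {y z} → y ≤ z → x + y ≤ x + z
    *-nonNegative     : ∀ {x y} → 0# ≤ x → 0# ≤ y → 0# ≤ x * y

  open Bounds _≤_ public

  field
    supremum : (P : ℝ → Set) → ∃ P → ∃ (UpperBound P) → ∃ (IsSupremum P)

  commutativeRing : CommutativeRing 0ℓ 0ℓ
  commutativeRing = record { isCommutativeRing = isCommutativeRing }

  open CommutativeRing commutativeRing public
    using (semiring; ring; +-comm; +-assoc; +-identityʳ; +-identityˡ; -‿inverseʳ; *-identityʳ; *-identityˡ)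
  open IsTotalOrder isTotalOrder public
    using () renaming (refl to ≤-refl; trans to ≤-trans)
  open RingProperties ring using (-‿involutive)
  open Mult semiring public using () renaming (_×_ to _·_)
  open Sum semiring public using (sum; sum-syntax; *-distribˡ-sum; *-distribʳ-sum)

  -‿antitone : ∀ {x y} → x ≤ y → - y ≤ - x
  -‿antitone {x} {y} x≤y = subst₂ _≤_ (shift x y) (shift′ x y) (+-monoʳ-≤ (- x + - y) x≤y)
    where
    open ≡-Reasoning
    shift : ∀ x y → - x + - y + x ≡ - y
    shift x y = begin
      - x + - y + x    ≡⟨ +-comm _ x ⟩
      x + (- x + - y)  ≡⟨ sym (+-assoc x (- x) (- y)) ⟩
      x + - x + - y    ≡⟨ cong (_+ - y) (-‿inverseʳ x) ⟩
      0# + - y         ≡⟨ +-identityˡ _ ⟩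
      - y              ∎
    shift′ : ∀ x y → - x + - y + y ≡ - x
    shift′ x y = trans (cong (_+ y) (+-comm (- x) (- y))) (shift y x)

  infimum : (P : ℝ → Set) → ∃ P → ∃ (LowerBound P) → ∃ (IsInfimum P)
  infimum P (p , Pp) (b , b≤P) =
    - s , (λ {x} Px → subst (- s ≤_) (-‿involutive x) (-‿antitone (proj₁ s-sup (neg∈ Px))))
        , (λ {c} c≤P → subst (_≤ - s) (-‿involutive c)
             (-‿antitone (proj₂ s-sup λ {x} Px → flip≤ (c≤P Px))))
    where
    neg∈ : ∀ {x} → P x → P (- - x)
    neg∈ {x} = subst P (sym (-‿involutive x))
    flip≤ : ∀ {x y} → x ≤ - y → y ≤ - x
    flip≤ {x} {y} x≤-y = subst (_≤ - x) (-‿involutive y) (-‿antitone x≤-y)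
    s∃ : ∃ (IsSupremum (P ∘ -_))
    s∃ = supremum (P ∘ -_) (- p , neg∈ Pp) (- b , λ Px → flip≤ (b≤P Px))
    s : ℝ
    s = proj₁ s∃
    s-sup : IsSupremum (P ∘ -_) s
    s-sup = proj₂ s∃

  sum-nonNegative : ∀ {n} {f : Fin n → ℝ} → (∀ i → 0# ≤ f i) → 0# ≤ sum f
  sum-nonNegative {zero}      0≤f = ≤-refl
  sum-nonNegative {suc n} {f} 0≤f =
    ≤-trans (0≤f zero)
      (subst (_≤ f zero + sum (f ∘ suc)) (+-identityʳ (f zero))
        (+-monoʳ-≤ (f zero) (sum-nonNegative (0≤f ∘ suc))))

record FiniteMetricSpace (R : Reals) : Set₁ where
  open Reals R
  field
    X           : Set
    size        : ℕ
    enumeration : Fin size ↔ X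
    d           : X → X → ℝ
    isMetric    : IsGeneralMetric _≡_ _≡_ _≤_ 0# _+_ d

  open IsGeneralMetric isMetric public using (nonNegative)

  ∑X : (X → ℝ) → ℝ
  ∑X f = sum (f ∘ Inverse.to enumeration)

  ∑X-distribˡ : ∀ a f → a * ∑X f ≡ ∑X (λ ρ → a * f ρ)
  ∑X-distribˡ a f = *-distribˡ-sum {size} a (f ∘ Inverse.to enumeration)

  ∑X-distribʳ : ∀ a f → ∑X f * a ≡ ∑X (λ ρ → f ρ * a)
  ∑X-distribʳ a f = *-distribʳ-sum {size} a (f ∘ Inverse.to enumeration)

  ∑X-nonNegative : ∀ {f} → (∀ ρ → 0# ≤ f ρ) → 0# ≤ ∑X f
  ∑X-nonNegative 0≤f = sum-nonNegative {size} (0≤f ∘ Inverse.to enumeration)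

-- Excluded middle is used only to give every series of non-negative terms a
-- value in [0,∞].

module MTS (em : ExcludedMiddle 0ℓ) (R : Reals) (M : FiniteMetricSpace R) (k : ℕ) where
  open Reals R
  open FiniteMetricSpace M

  ℝ∞ : Set
  ℝ∞ = ℝ ⁺

  open AddSupremum _≤_ public using () renaming (_≤⁺_ to _≤∞_)

  infixl 6 _+∞_
  _+∞_ : ℝ∞ → ℝ∞ → ℝ∞
  [ x ] +∞ [ y ] = [ x + y ]
  [ x ] +∞ ⊤⁺    = ⊤⁺
  ⊤⁺    +∞ _     = ⊤⁺

  PartialSum : (ℕ → ℝ) → ℝ → Set
  PartialSum f r = ∃[ n ] r ≡ ∑[ i < n ] f (toℕ i)

  -- The sum of a series of non-negative terms.
  series : (ℕ → ℝ) → ℝ∞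
  series f = value∞ em
    where
    value∞ : Dec (∃ (UpperBound (PartialSum f))) → ℝ∞
    value∞ (yes bounded) = [ proj₁ (supremum (PartialSum f) (0# , 0 , refl) bounded) ]
    value∞ (no  _)       = ⊤⁺

  infix 7 _/k
  _/k : ℕ → ℝ
  m /k = (m · 1#) * (k · 1#) ⁻¹

  -- Expectation under the uniform distribution on the k seeds.
  𝔼 : (Fin k → ℝ∞) → ℝ∞
  𝔼 f = scale (Vector.foldr _+∞_ [ 0# ] f)
    where
    scale : ℝ∞ → ℝ∞
    scale [ r ] = [ (1 /k) * r ]
    scale ⊤⁺    = ⊤⁺

  ℝ₊ : Set
  ℝ₊ = [ r ∈ ℝ ∣ 0# ≤ r ]

  CostVector : Set
  CostVector = X → ℝ₊

  -- Time is shifted: `c t` is the cost vector revealed at time t + 1, so that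
  -- `applyUpTo c t` lists the cost vectors of times 1, …, t.
  CostSequence : Set
  CostSequence = ℕ → CostVector

  record 𝒫 : Set where
    field
      weight       : X → ℝ
      weight≥0     : ∀ ρ → 0# ≤ weight ρ
      total-weight : ∑X weight ≡ 1#
  open 𝒫 public

  record 𝒫ₖ : Set where
    field
      dist       : 𝒫
      multiple/k : ∀ ρ → ∃[ m ] m ℕ.≤ k × weight dist ρ ≡ m /k
  open 𝒫ₖ public

  -- That the total mass is 1 follows from either marginal.
  record Coupling (x x′ : 𝒫) : Set where
    field
      plan      : X → X → ℝ
      plan≥0    : ∀ ρ ρ′ → 0# ≤ plan ρ ρ′
      marginalˡ : ∀ ρ  → ∑X (λ ρ′ → plan ρ ρ′) ≡ weight x ρ
      marginalʳ : ∀ ρ′ → ∑X (λ ρ → plan ρ ρ′) ≡ weight x′ ρ′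

    transportCost : ℝ
    transportCost = ∑X λ ρ → ∑X λ ρ′ → plan ρ ρ′ * d ρ ρ′
  open Coupling public

  productCoupling : ∀ x x′ → Coupling x x′
  productCoupling x x′ = record
    { plan      = λ ρ ρ′ → weight x ρ * weight x′ ρ′
    ; plan≥0    = λ ρ ρ′ → *-nonNegative (weight≥0 x ρ) (weight≥0 x′ ρ′)
    ; marginalˡ = λ ρ → trans (sym (∑X-distribˡ (weight x ρ) (weight x′)))
                    (trans (cong (weight x ρ *_) (total-weight x′)) (*-identityʳ _))
    ; marginalʳ = λ ρ′ → trans (sym (∑X-distribʳ (weight x′ ρ′) (weight x)))
                    (trans (cong (_* weight x′ ρ′) (total-weight x)) (*-identityˡ _))
    }

  TransportCost : 𝒫 → 𝒫 → ℝ → Set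
  TransportCost x x′ r = Σ[ π ∈ Coupling x x′ ] r ≡ transportCost π

  transportCost≥0 : ∀ {x x′} (π : Coupling x x′) → 0# ≤ transportCost π
  transportCost≥0 π = ∑X-nonNegative λ ρ → ∑X-nonNegative λ ρ′ →
    *-nonNegative (plan≥0 π ρ ρ′) (nonNegative {ρ} {ρ′})

  OT : 𝒫 → 𝒫 → ℝ
  OT x x′ = proj₁ (infimum (TransportCost x x′)
    (_ , productCoupling x x′ , refl)
    (0# , λ { (π , refl) → transportCost≥0 π }))

  RandomAlgorithm : Set
  RandomAlgorithm = List CostVector → Fin k → X

  FractionalStrategy : Set
  FractionalStrategy = List CostVector → 𝒫ₖ

  pathCost : (ℕ → X) → CostSequence → ℝ∞
  pathCost ρ c = series λ t → d (ρ t) (ρ (suc t)) + value (c t (ρ (suc t)))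

  randomCost : RandomAlgorithm → CostSequence → ℝ∞
  randomCost A c = 𝔼 λ s → pathCost (λ t → A (applyUpTo c t) s) c

  fractionalCost : FractionalStrategy → CostSequence → ℝ∞
  fractionalCost x c = series λ t →
    OT (dist (x (applyUpTo c t))) (dist (x (applyUpTo c (suc t))))
      + ∑X λ ρ → weight (dist (x (applyUpTo c (suc t)))) ρ * value (c t ρ)

{-# OPTIONS --safe #-}
module Submission where

-- A k-barely random algorithm is a motion of k tokens, one per seed, and its position at each
-- time is a distribution in 𝒫ₖ. The motion of the tokens is a coupling, so it costs at least OT.
-- Conversely OT is attained by a motion of the tokens. Among the finitely many ways b of placing
-- the tokens according to the new distribution take one of least cost from the present
-- positions a. In the graph on X with edges of length d and jumps b s → a s of length
-- − d (a s) (b s), every cycle is non-negative: a simple one because shifting b along it cannot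
-- improve b, the others by erasing loops. Hence shortest walks from a base point define a
-- potential v, which is 1-Lipschitz and satisfies v (b s) − v (a s) ≥ d (a s) (b s), and
-- integrating v against any coupling bounds its cost below by that of b (Kantorovich duality).
-- The costs then agree step by step, and 𝔼 commutes with series of non-negative terms.

open import Defs
open import Algebra.Bundles using (CommutativeRing)
import Algebra.Properties.AbelianGroup as AbelianGroupProperties
import Algebra.Properties.Ring as RingProperties
import Algebra.Properties.Semiring.Sum as Sum
import Algebra.Solver.Ring.NaturalCoefficients.Default as SemiringSolver
open import Axiom.ExcludedMiddle using (ExcludedMiddle)
open import Data.Bool.Base using (if_then_else_)
open import Data.Fin.Base using (Fin; zero; suc; toℕ; punchIn; funToFin; finToFun; fromℕ<)
open import Data.Fin.Properties using (_≟_; punchInᵢ≢i; finToFun-funToFin)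
open import Data.Irrelevant using ([_])
open import Data.List.Base using (List; []; _∷_; _++_; _∷ʳ_; reverse; applyUpTo)
open import Data.List.Membership.Propositional using (_∈_)
open import Data.List.Membership.Propositional.Properties using (∈-∃++)
open import Data.List.Properties using (reverse-++; reverse-involutive; applyUpTo-∷ʳ)
open import Data.List.Relation.Unary.All as All using (All; []; _∷_)
import Data.List.Relation.Unary.All.Properties as All
open import Data.List.Relation.Unary.AllPairs using ([]; _∷_)
open import Data.List.Relation.Unary.Unique.Propositional using (Unique)
open import Data.Nat.Base as ℕ using (ℕ; zero; suc; NonZero; z≤n; s≤s)
import Data.Nat.Properties as ℕ
open import Data.Product.Base using (Σ-syntax; ∃; ∃-syntax; _×_; _,_; proj₁; proj₂)
open import Data.Refinement using (value; _,_)
open import Data.Sum.Base using (inj₁; inj₂)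
open import Data.Vec.Base as Vec using (count)
open import Data.Vec.Properties using (count≤n)
import Data.Vec.Functional as Vector
open import Data.Vec.Functional.Properties using (updateAt-updates; updateAt-minimal)
open import Function.Base using (_∘_; const)
open import Function.Bundles using (Inverse)
open import Function.Metric.Structures using (IsGeneralMetric)
open import Level using (0ℓ)
open import Relation.Binary.Bundles using (Poset)
import Relation.Binary.Reasoning.PartialOrder as PartialOrderReasoning
open import Relation.Binary.PropositionalEquality
  using (_≡_; _≢_; _≗_; refl; sym; trans; cong; cong₂; subst; subst₂; module ≡-Reasoning)
open import Relation.Binary.Structures using (IsTotalOrder)
open import Relation.Nullary using (¬_; Dec; does; yes; no; contradiction)
open import Relation.Nullary.Decidable.Core using (recompute)
open import Relation.Nullary.Construct.Add.Supremum using ([_]; ⊤⁺)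
open import Relation.Binary.Construct.Add.Supremum.NonStrict using ([_]; _≤⊤⁺)

-- Ordered field arithmetic and finite sums.

module RealProperties (R : Reals) where
  open Reals R public
  open IsTotalOrder isTotalOrder public
    using () renaming (antisym to ≤-antisym; reflexive to ≤-reflexive; total to ≤-total; isPartialOrder to ≤-isPartialOrder)
  open CommutativeRing commutativeRing public
    using (commutativeSemiring; +-abelianGroup; distribˡ; distribʳ; zeroʳ; zeroˡ; *-comm; *-assoc; -‿inverseˡ)
  open Sum semiring public using (sum-cong-≗; ∑-distrib-+; ∑-comm; sum-remove; sum-replicate-zero; sum-replicate)
  open AbelianGroupProperties +-abelianGroup public using () renaming (∙-cancelʳ to +-cancelʳ)
  open RingProperties ring using (-‿distribʳ-*; -‿involutive)
  open SemiringSolver commutativeSemiring public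
    using (_:=_; _:+_; _:*_) renaming (solve to solve-semiring)

  poset : Poset 0ℓ 0ℓ 0ℓ
  poset = record { isPartialOrder = ≤-isPartialOrder }

  module ≤-Reasoning = PartialOrderReasoning poset

  +-monoˡ-≤ : ∀ z {x y} → x ≤ y → x + z ≤ y + z
  +-monoˡ-≤ z x≤y = subst₂ _≤_ (+-comm z _) (+-comm z _) (+-monoʳ-≤ z x≤y)

  +-mono-≤ : ∀ {x y u v} → x ≤ y → u ≤ v → x + u ≤ y + v
  +-mono-≤ x≤y u≤v = ≤-trans (+-monoˡ-≤ _ x≤y) (+-monoʳ-≤ _ u≤v)

  x+y-y : ∀ x y → x + y + - y ≡ x
  x+y-y x y = trans (+-assoc x y (- y)) (trans (cong (x +_) (-‿inverseʳ y)) (+-identityʳ x))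

  x-y+y : ∀ x y → x + - y + y ≡ x
  x-y+y x y = trans (+-assoc x (- y) y) (trans (cong (x +_) (-‿inverseˡ y)) (+-identityʳ x))

  +-cancelʳ-≤ : ∀ z {x y} → x + z ≤ y + z → x ≤ y
  +-cancelʳ-≤ z le = subst₂ _≤_ (x+y-y _ z) (x+y-y _ z) (+-monoˡ-≤ (- z) le)

  x+y≤z⇒x≤z-y : ∀ {x y z} → x + y ≤ z → x ≤ z + - y
  x+y≤z⇒x≤z-y {x} {y} {z} le = subst (_≤ z + - y) (x+y-y x y) (+-monoˡ-≤ (- y) le)

  x≤z-y⇒x+y≤z : ∀ {x y z} → x ≤ z + - y → x + y ≤ z
  x≤z-y⇒x+y≤z {x} {y} {z} le = subst (x + y ≤_) (x-y+y z y) (+-monoˡ-≤ y le)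

  x≤y+z⇒x-z≤y : ∀ {x y z} → x ≤ y + z → x + - z ≤ y
  x≤y+z⇒x-z≤y {x} {y} {z} le = subst (x + - z ≤_) (x+y-y y z) (+-monoˡ-≤ (- z) le)

  x-z≤y⇒x≤y+z : ∀ {x y z} → x + - z ≤ y → x ≤ y + z
  x-z≤y⇒x≤y+z {x} {y} {z} le = subst (_≤ y + z) (x-y+y x z) (+-monoˡ-≤ z le)

  x≤x+y : ∀ x {y} → 0# ≤ y → x ≤ x + y
  x≤x+y x {y} 0≤y = subst (_≤ x + y) (+-identityʳ x) (+-monoʳ-≤ x 0≤y)

  x≤y+x : ∀ x {y} → 0# ≤ y → x ≤ y + x
  x≤y+x x {y} 0≤y = subst (x ≤_) (+-comm x y) (x≤x+y x 0≤y)

  +-nonNegative : ∀ {x y} → 0# ≤ x → 0# ≤ y → 0# ≤ x + y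
  +-nonNegative 0≤x 0≤y = ≤-trans 0≤x (x≤x+y _ 0≤y)

  *-monoˡ-≤ : ∀ {a x y} → 0# ≤ a → x ≤ y → a * x ≤ a * y
  *-monoˡ-≤ {a} {x} {y} 0≤a x≤y = begin
    a * x                    ≤⟨ x≤y+x (a * x) (*-nonNegative 0≤a 0≤y-x) ⟩
    a * (y + - x) + a * x    ≡⟨ sym (distribˡ a (y + - x) x) ⟩
    a * (y + - x + x)        ≡⟨ cong (a *_) (x-y+y y x) ⟩
    a * y                    ∎
    where
    open ≤-Reasoning
    0≤y-x : 0# ≤ y + - x
    0≤y-x = x+y≤z⇒x≤z-y (subst (_≤ y) (sym (+-identityˡ x)) x≤y)

  x≤0⇒0≤-x : ∀ {x} → x ≤ 0# → 0# ≤ - x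
  x≤0⇒0≤-x {x} x≤0 = subst (0# ≤_) (+-identityˡ (- x)) (x+y≤z⇒x≤z-y (subst (_≤ 0#) (sym (+-identityˡ x)) x≤0))

  0≤1 : 0# ≤ 1#
  0≤1 with ≤-total 0# 1#
  ... | inj₁ le = le
  ... | inj₂ 1≤0 = subst (0# ≤_) eq (*-nonNegative (x≤0⇒0≤-x 1≤0) (x≤0⇒0≤-x 1≤0))
    where
    eq : - 1# * - 1# ≡ 1#
    eq = trans (sym (-‿distribʳ-* (- 1#) 1#)) (trans (cong -_ (*-identityʳ _)) (-‿involutive 1#))

  ¬1≤0 : ¬ 1# ≤ 0#
  ¬1≤0 1≤0 = 0≢1 (≤-antisym 0≤1 1≤0)

  n·1≥0 : ∀ n → 0# ≤ n · 1#
  n·1≥0 zero    = ≤-refl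
  n·1≥0 (suc n) = +-nonNegative 0≤1 (n·1≥0 n)

  1+n·1≢0 : ∀ n → suc n · 1# ≢ 0#
  1+n·1≢0 n eq = ¬1≤0 (subst (1# ≤_) eq (x≤x+y 1# (n·1≥0 n)))

  ·1-injective : ∀ {m n} → m · 1# ≡ n · 1# → m ≡ n
  ·1-injective {zero}  {zero}  eq = refl
  ·1-injective {zero}  {suc n} eq = contradiction (sym eq) (1+n·1≢0 n)
  ·1-injective {suc m} {zero}  eq = contradiction eq (1+n·1≢0 m)
  ·1-injective {suc m} {suc n} eq = cong suc (·1-injective
    (+-cancelʳ 1# _ _ (trans (+-comm _ 1#) (trans eq (+-comm 1# _)))))

  ⁻¹-nonNegative : ∀ {x} → 0# ≤ x → x ≢ 0# → 0# ≤ x ⁻¹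
  ⁻¹-nonNegative {x} 0≤x x≢0 with ≤-total 0# (x ⁻¹)
  ... | inj₁ le = le
  ... | inj₂ x⁻¹≤0 = contradiction
    (subst₂ _≤_ (*-inverseʳ x x≢0) (zeroʳ x) (*-monoˡ-≤ 0≤x x⁻¹≤0)) ¬1≤0

  sum-mono-≤ : ∀ {n} {f g : Fin n → ℝ} → (∀ i → f i ≤ g i) → sum f ≤ sum g
  sum-mono-≤ {zero}  f≤g = ≤-refl
  sum-mono-≤ {suc n} f≤g = +-mono-≤ (f≤g zero) (sum-mono-≤ (f≤g ∘ suc))

  -- The identity for the difference of two sums that agree off `i`, cross-added so that it stays
  -- within the reach of the semiring solver.
  sum-exchange : ∀ {n} (f g : Fin n → ℝ) i → (∀ j → j ≢ i → f j ≡ g j) →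
                 sum f + g i ≡ sum g + f i
  sum-exchange {suc n} f g i f≡g = begin
    sum f + g i                            ≡⟨ cong (_+ g i) (sum-remove {i = i} f) ⟩
    f i + sum (Vector.removeAt f i) + g i  ≡⟨ cong (λ z → f i + z + g i) (sum-cong-≗ λ j → f≡g (punchIn i j) (punchInᵢ≢i i j)) ⟩
    f i + sum (Vector.removeAt g i) + g i  ≡⟨ solve-semiring 3 (λ x y z → x :+ y :+ z := z :+ y :+ x) refl (f i) (sum (Vector.removeAt g i)) (g i) ⟩
    g i + sum (Vector.removeAt g i) + f i  ≡⟨ cong (_+ f i) (sym (sum-remove {i = i} g)) ⟩
    sum g + f i                            ∎
    where open ≡-Reasoning

  sum-exchange₂ : ∀ {n} (f g : Fin n → ℝ) {i j} → i ≢ j → (∀ l → l ≢ i → l ≢ j → f l ≡ g l) →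
                  sum f + (g i + g j) ≡ sum g + (f i + f j)
  sum-exchange₂ {n} f g {i} {j} i≢j f≡g = begin
    sum f + (g i + g j)  ≡⟨ sym (+-assoc _ _ _) ⟩
    sum f + g i + g j    ≡⟨ cong (_+ g j) (trans (cong (sum f +_) (sym hi)) (sum-exchange f h i λ l l≢i → sym (updateAt-minimal l i f l≢i))) ⟩
    sum h + f i + g j    ≡⟨ solve-semiring 3 (λ x y z → x :+ y :+ z := x :+ z :+ y) refl (sum h) (f i) (g j) ⟩
    sum h + g j + f i    ≡⟨ cong (_+ f i) (trans (sum-exchange h g j h≡g) (cong (sum g +_) (updateAt-minimal j i f (i≢j ∘ sym)))) ⟩
    sum g + f j + f i    ≡⟨ solve-semiring 3 (λ x y z → x :+ y :+ z := x :+ (z :+ y)) refl (sum g) (f j) (f i) ⟩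
    sum g + (f i + f j)  ∎
    where
    open ≡-Reasoning
    -- A hybrid of the two families, `g` at `i` and `f` elsewhere, so that each exchange concerns a
    -- single index.
    h : Fin n → ℝ
    h = Vector.updateAt f i (const (g i))
    hi : h i ≡ g i
    hi = updateAt-updates i f
    h≡g : ∀ l → l ≢ j → h l ≡ g l
    h≡g l l≢j with l ≟ i
    ... | yes refl = hi
    ... | no l≢i = trans (updateAt-minimal l i f l≢i) (f≡g l l≢i l≢j)

  -- `infimum` is built by negating a supremum. Having its defining property for an arbitrary
  -- supremum allows it to be recovered for `OT`, which unfolds to such a negation.
  -supremum-isInfimum : ∀ {P s} → IsSupremum (P ∘ -_) s → IsInfimum P (- s)
  -supremum-isInfimum {P} {s} (P≤s , s-least) =
      (λ {x} Px → subst (- s ≤_) (-‿involutive x) (-‿antitone (P≤s (subst P (sym (-‿involutive x)) Px))))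
    , λ {c} c≤P → subst (_≤ - s) (-‿involutive c)
        (-‿antitone (s-least λ {x} P-x → subst (_≤ - c) (-‿involutive x) (-‿antitone (c≤P P-x))))

  infimum-family : {I : Set} (F : I → ℝ) → I → ∃ (λ b → ∀ i → b ≤ F i) →
                   Σ[ m ∈ ℝ ] (∀ i → m ≤ F i) × (∀ {b} → (∀ i → b ≤ F i) → b ≤ m)
  infimum-family F i (b , b≤F) with infimum (λ r → ∃ λ i → r ≡ F i) (_ , i , refl) (b , λ { (j , refl) → b≤F j })
  ... | m , m≤ , greatest = m , (λ j → m≤ (j , refl)) , λ c≤F → greatest λ { (j , refl) → c≤F j }

-- Series of non-negative terms with values in [0,∞].

module SeriesProperties (em : ExcludedMiddle 0ℓ) (R : Reals) (M : FiniteMetricSpace R) (k : ℕ) where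
  open RealProperties R
  open MTS em R M k

  partialSum : (ℕ → ℝ) → ℕ → ℝ
  partialSum f n = ∑[ i < n ] f (toℕ i)

  partialSum-mono : ∀ {f} → (∀ t → 0# ≤ f t) → ∀ {m n} → m ℕ.≤ n → partialSum f m ≤ partialSum f n
  partialSum-mono f≥0 {n = n} z≤n = sum-nonNegative {n} (f≥0 ∘ toℕ)
  partialSum-mono {f} f≥0 (s≤s m≤n) = +-monoʳ-≤ (f 0) (partialSum-mono (f≥0 ∘ suc) m≤n)

  Bounded : (ℕ → ℝ) → Set
  Bounded f = ∃ (UpperBound (PartialSum f))

  infix 4 _⇓_
  -- The value of a series as a relation, so that sums and multiples are evaluated through bounds
  -- and not through the case split on `em` inside `series`. `⇓-unique` makes it functional.
  _⇓_ : (ℕ → ℝ) → ℝ∞ → Set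
  f ⇓ [ r ] = IsSupremum (PartialSum f) r
  f ⇓ ⊤⁺    = ¬ Bounded f

  series-⇓ : ∀ f → f ⇓ series f
  series-⇓ f with em {Bounded f}
  ... | yes bounded  = proj₂ (supremum (PartialSum f) (0# , 0 , refl) bounded)
  ... | no ¬bounded  = ¬bounded

  ⇓-mono : ∀ {f g} → (∀ t → f t ≤ g t) → ∀ x y → f ⇓ x → g ⇓ y → x ≤∞ y
  ⇓-mono f≤g x ⊤⁺ _ _ = x ≤⊤⁺
  ⇓-mono f≤g [ r ] [ s ] (_ , r-least) (g≤s , _) =
    [ r-least (λ { (n , refl) → ≤-trans (sum-mono-≤ {n} (f≤g ∘ toℕ)) (g≤s (n , refl)) }) ]
  ⇓-mono f≤g ⊤⁺ [ s ] f-unbounded (g≤s , _) = contradiction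
    (s , λ { (n , refl) → ≤-trans (sum-mono-≤ {n} (f≤g ∘ toℕ)) (g≤s (n , refl)) }) f-unbounded

  ≤∞-antisym : ∀ {x y} → x ≤∞ y → y ≤∞ x → x ≡ y
  ≤∞-antisym [ p ] [ q ] = cong [_] (≤-antisym p q)
  ≤∞-antisym (_ ≤⊤⁺) (_ ≤⊤⁺) = refl

  ⇓-unique : ∀ {f x y} → f ⇓ x → f ⇓ y → x ≡ y
  ⇓-unique {x = x} {y} f⇓x f⇓y =
    ≤∞-antisym (⇓-mono (λ _ → ≤-refl) x y f⇓x f⇓y) (⇓-mono (λ _ → ≤-refl) y x f⇓y f⇓x)

  series-mono : ∀ {f g} → (∀ t → f t ≤ g t) → series f ≤∞ series g
  series-mono {f} {g} f≤g = ⇓-mono f≤g (series f) (series g) (series-⇓ f) (series-⇓ g)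

  series-cong : ∀ {f g} → f ≗ g → series f ≡ series g
  series-cong f≗g = ≤∞-antisym (series-mono (≤-reflexive ∘ f≗g)) (series-mono (≤-reflexive ∘ sym ∘ f≗g))

  0-⇓ : (λ _ → 0#) ⇓ [ 0# ]
  0-⇓ = (λ { (n , refl) → ≤-reflexive (sum-replicate-zero n) }) , λ 0≤b → 0≤b (0 , refl)

  +-⇓ : ∀ {f g} → (∀ t → 0# ≤ f t) → (∀ t → 0# ≤ g t) →
        ∀ x y → f ⇓ x → g ⇓ y → (λ t → f t + g t) ⇓ (x +∞ y)
  +-⇓ {f} {g} f≥0 g≥0 = go
    where
    open ≤-Reasoning
    split : ∀ n → partialSum (λ t → f t + g t) n ≡ partialSum f n + partialSum g n
    split n = ∑-distrib-+ {n} (f ∘ toℕ) (g ∘ toℕ)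
    -- The suprema of `f` and `g` are taken over independent truncations. Partial sums of
    -- non-negative terms increase, so both can be raised to the larger one.
    diagonal : ∀ {b} → UpperBound (PartialSum (λ t → f t + g t)) b →
               ∀ m n → partialSum f m + partialSum g n ≤ b
    diagonal {b} f+g≤b m n = begin
      partialSum f m + partialSum g n              ≤⟨ +-mono-≤ (partialSum-mono f≥0 (ℕ.m≤m⊔n m n)) (partialSum-mono g≥0 (ℕ.m≤n⊔m m n)) ⟩
      partialSum f (m ℕ.⊔ n) + partialSum g (m ℕ.⊔ n)  ≡⟨ sym (split (m ℕ.⊔ n)) ⟩
      partialSum (λ t → f t + g t) (m ℕ.⊔ n)       ≤⟨ f+g≤b (m ℕ.⊔ n , refl) ⟩
      b                                            ∎
    bounded-f : Bounded (λ t → f t + g t) → Bounded f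
    bounded-f (b , f+g≤b) = b , λ { (n , refl) → subst (_≤ b) (+-identityʳ _) (diagonal f+g≤b n 0) }
    bounded-g : Bounded (λ t → f t + g t) → Bounded g
    bounded-g (b , f+g≤b) = b , λ { (n , refl) → subst (_≤ b) (+-identityˡ _) (diagonal f+g≤b 0 n) }
    go : ∀ x y → f ⇓ x → g ⇓ y → (λ t → f t + g t) ⇓ (x +∞ y)
    go [ r ] [ s ] (f≤r , r-least) (g≤s , s-least) =
        (λ { (n , refl) → subst (_≤ r + s) (sym (split n)) (+-mono-≤ (f≤r (n , refl)) (g≤s (n , refl))) })
      -- An iterated supremum: for fixed `n` first over `m`, which puts `r` in place of the partial
      -- sum of `f`, and then over `n`.
      , λ {b} f+g≤b → subst (_≤ b) (+-comm s r) (x≤z-y⇒x+y≤z (s-least λ { (n , refl) →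
          x+y≤z⇒x≤z-y (subst (_≤ b) (+-comm r _) (x≤z-y⇒x+y≤z (r-least λ { (m , refl) →
            x+y≤z⇒x≤z-y (diagonal f+g≤b m n) }))) }))
    go [ r ] ⊤⁺ _ g-unbounded = g-unbounded ∘ bounded-g
    go ⊤⁺ y f-unbounded _     = f-unbounded ∘ bounded-f

  sum-⇓ : ∀ {n} (f : Fin n → ℕ → ℝ) → (∀ s t → 0# ≤ f s t) →
          (λ t → sum (λ s → f s t)) ⇓ Vector.foldr _+∞_ [ 0# ] (series ∘ f)
  sum-⇓ {zero}  f f≥0 = 0-⇓
  sum-⇓ {suc n} f f≥0 = +-⇓ (f≥0 zero) (λ t → sum-nonNegative (λ s → f≥0 (suc s) t))
    (series (f zero)) _ (series-⇓ (f zero)) (sum-⇓ (f ∘ suc) (f≥0 ∘ suc))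

  -- The inverse of the factor is given explicitly. In `𝔼-series` the pair is `1 /k` and `k · 1#`.
  *-cancel-bound : ∀ {a b f c} → 0# ≤ b → b * a ≡ 1# →
                   UpperBound (PartialSum (λ t → a * f t)) c → UpperBound (PartialSum f) (b * c)
  *-cancel-bound {a} {b} {f} {c} b≥0 ba≡1 af≤c (n , refl) =
    subst (_≤ b * c) unscale (*-monoˡ-≤ b≥0 (af≤c (n , refl)))
    where
    open ≡-Reasoning
    unscale : b * partialSum (λ t → a * f t) n ≡ partialSum f n
    unscale = begin
      b * partialSum (λ t → a * f t) n  ≡⟨ cong (b *_) (sym (*-distribˡ-sum {n} a (f ∘ toℕ))) ⟩
      b * (a * partialSum f n)          ≡⟨ sym (*-assoc b a _) ⟩
      b * a * partialSum f n            ≡⟨ cong (_* partialSum f n) ba≡1 ⟩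
      1# * partialSum f n               ≡⟨ *-identityˡ _ ⟩
      partialSum f n                    ∎

  *-⇓ : ∀ {a b f r} → 0# ≤ a → 0# ≤ b → b * a ≡ 1# → f ⇓ [ r ] → (λ t → a * f t) ⇓ [ a * r ]
  *-⇓ {a} {b} {f} {r} a≥0 b≥0 ba≡1 (f≤r , r-least) =
      (λ { (n , refl) → subst (_≤ a * r) (*-distribˡ-sum {n} a (f ∘ toℕ)) (*-monoˡ-≤ a≥0 (f≤r (n , refl))) })
    , λ {c} af≤c → subst (a * r ≤_) (rescale c)
        (*-monoˡ-≤ a≥0 (r-least (*-cancel-bound {a} {b} {f} b≥0 ba≡1 af≤c)))
    where
    open ≡-Reasoning
    rescale : ∀ c → a * (b * c) ≡ c
    rescale c = begin
      a * (b * c)  ≡⟨ solve-semiring 3 (λ x y z → x :* (y :* z) := y :* x :* z) refl a b c ⟩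
      b * a * c    ≡⟨ cong (_* c) ba≡1 ⟩
      1# * c       ≡⟨ *-identityˡ c ⟩
      c            ∎

  *-⇓-∞ : ∀ {a b f} → 0# ≤ b → b * a ≡ 1# → f ⇓ ⊤⁺ → (λ t → a * f t) ⇓ ⊤⁺
  *-⇓-∞ {a} {b} {f} b≥0 ba≡1 f-unbounded (c , af≤c) =
    f-unbounded (b * c , *-cancel-bound {a} {b} {f} b≥0 ba≡1 af≤c)

-- Averages over the seeds.

module BarelyRandom (em : ExcludedMiddle 0ℓ) (R : Reals) (M : FiniteMetricSpace R) (k : ℕ) .{{_ : NonZero k}} where
  open RealProperties R
  open FiniteMetricSpace M
  open IsGeneralMetric isMetric using (triangle; ≈⇒0)
  open MTS em R M k
  open SeriesProperties em R M k

  k·1≢0 : k · 1# ≢ 0#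
  k·1≢0 = subst (λ n → n · 1# ≢ 0#) (ℕ.suc-pred k) (1+n·1≢0 (ℕ.pred k))

  1/k≡ : 1 /k ≡ (k · 1#) ⁻¹
  1/k≡ = trans (cong (_* (k · 1#) ⁻¹) (+-identityʳ 1#)) (*-identityˡ _)

  1/k≥0 : 0# ≤ 1 /k
  1/k≥0 = subst (0# ≤_) (sym 1/k≡) (⁻¹-nonNegative (n·1≥0 k) k·1≢0)

  k*1/k : k · 1# * (1 /k) ≡ 1#
  k*1/k = trans (cong (k · 1# *_) 1/k≡) (*-inverseʳ _ k·1≢0)

  m/k≡ : ∀ m → m /k ≡ (1 /k) * m · 1#
  m/k≡ m = trans (*-comm _ _) (cong (_* m · 1#) (sym 1/k≡))

  avg : (Fin k → ℝ) → ℝ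
  avg f = (1 /k) * sum f

  -- Turns the expected cost into a single series of averages, which can be compared with the
  -- fractional cost one time step at a time.
  𝔼-series : (f : Fin k → ℕ → ℝ) → (∀ s t → 0# ≤ f s t) →
             𝔼 (series ∘ f) ≡ series (λ t → avg λ s → f s t)
  𝔼-series f f≥0 with Vector.foldr _+∞_ [ 0# ] (series ∘ f) | sum-⇓ f f≥0
  ... | [ r ] | sum⇓ = ⇓-unique {f = λ t → avg λ s → f s t} {y = series _}
    (*-⇓ {f = λ t → sum λ s → f s t} 1/k≥0 (n·1≥0 k) k*1/k sum⇓) (series-⇓ _)
  ... | ⊤⁺    | sum⇓ = ⇓-unique {f = λ t → avg λ s → f s t} {y = series _}
    (*-⇓-∞ {f = λ t → sum λ s → f s t} (n·1≥0 k) k*1/k sum⇓) (series-⇓ _)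

  avg-cong : ∀ {f g} → f ≗ g → avg f ≡ avg g
  avg-cong f≗g = cong ((1 /k) *_) (sum-cong-≗ f≗g)

  avg-mono : ∀ {f g} → (∀ s → f s ≤ g s) → avg f ≤ avg g
  avg-mono f≤g = *-monoˡ-≤ 1/k≥0 (sum-mono-≤ f≤g)

  avg-nonNegative : ∀ {f} → (∀ s → 0# ≤ f s) → 0# ≤ avg f
  avg-nonNegative f≥0 = *-nonNegative 1/k≥0 (sum-nonNegative f≥0)

  avg-+ : ∀ f g → avg (λ s → f s + g s) ≡ avg f + avg g
  avg-+ f g = trans (cong ((1 /k) *_) (∑-distrib-+ f g)) (distribˡ _ _ _)

  avg-*ʳ : ∀ f c → avg f * c ≡ avg (λ s → f s * c)
  avg-*ʳ f c = trans (*-assoc _ _ _) (cong ((1 /k) *_) (*-distribʳ-sum c f))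

  sum-avg : ∀ {n} (f : Fin n → Fin k → ℝ) → sum (λ i → avg (f i)) ≡ avg (λ s → sum λ i → f i s)
  sum-avg {n} f = trans (sym (*-distribˡ-sum {n} (1 /k) (λ i → sum (f i))))
    (cong ((1 /k) *_) (∑-comm {n} {k} f))

  -- Point masses and empirical distributions of tokens.

  e : Fin size → X
  e = Inverse.to enumeration

  indicator : {P : Set} → Dec P → ℝ
  indicator p = if does p then 1# else 0#

  indicator≥0 : {P : Set} (p : Dec P) → 0# ≤ indicator p
  indicator≥0 (yes _) = 0≤1
  indicator≥0 (no _)  = ≤-refl

  indicator-yes : {P : Set} (p : Dec P) → P → indicator p ≡ 1#
  indicator-yes (yes _) _ = refl
  indicator-yes (no ¬p) p = contradiction p ¬p

  indicator-no : {P : Set} (p : Dec P) → ¬ P → indicator p ≡ 0#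
  indicator-no (yes p) ¬p = contradiction p ¬p
  indicator-no (no _)  _  = refl

  δ : X → X → ℝ
  δ x y = indicator (em {x ≡ y})

  δ-sym : ∀ x y → δ x y ≡ δ y x
  δ-sym x y with em {x ≡ y}
  ... | yes x≡y = sym (indicator-yes em (sym x≡y))
  ... | no  x≢y = sym (indicator-no em (x≢y ∘ sym))

  ∑X-δˡ : ∀ x f → ∑X (λ ρ → δ x ρ * f ρ) ≡ f x
  ∑X-δˡ x f = begin
    sum g                               ≡⟨ sym (+-identityʳ _) ⟩
    -- `g` is compared with the zero family, from which it differs at most at the index of `x`.
    sum g + 0#                          ≡⟨ sum-exchange g (λ _ → 0#) i₀ vanish ⟩
    sum {size} (λ _ → 0#) + g i₀        ≡⟨ cong (_+ g i₀) (sum-replicate-zero size) ⟩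
    0# + g i₀                           ≡⟨ +-identityˡ _ ⟩
    δ x (e i₀) * f (e i₀)               ≡⟨ cong₂ _*_ (indicator-yes em (sym e-i₀)) (cong f e-i₀) ⟩
    1# * f x                            ≡⟨ *-identityˡ _ ⟩
    f x                                 ∎
    where
    open ≡-Reasoning
    i₀ : Fin size
    i₀ = Inverse.from enumeration x
    e-i₀ : e i₀ ≡ x
    e-i₀ = Inverse.strictlyInverseˡ enumeration x
    g : Fin size → ℝ
    g i = δ x (e i) * f (e i)
    vanish : ∀ j → j ≢ i₀ → g j ≡ 0#
    vanish j j≢i₀ = trans
      (cong (_* f (e j)) (indicator-no em λ { refl → j≢i₀ (sym (Inverse.strictlyInverseʳ enumeration j)) }))
      (zeroˡ _)

  ∑X-δʳ : ∀ f x → ∑X (λ ρ → f ρ * δ ρ x) ≡ f x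
  ∑X-δʳ f x = trans (sum-cong-≗ {size} λ i → trans (*-comm _ _) (cong (_* f (e i)) (δ-sym (e i) x))) (∑X-δˡ x f)

  -- The law of `a s` for a uniform seed is `x`, expressed by integrals of test functions, the form
  -- in which costs and potentials use it. Testing with `δ` gives back the weights.
  Empirical : (Fin k → X) → 𝒫 → Set
  Empirical a x = ∀ f → ∑X (λ ρ → weight x ρ * f ρ) ≡ avg (f ∘ a)

  empirical-weight : ∀ {a x} → Empirical a x → ∀ ρ → weight x ρ ≡ avg (λ s → δ (a s) ρ)
  empirical-weight {x = x} emp ρ = trans (sym (∑X-δʳ (weight x) ρ)) (emp λ σ → δ σ ρ)

  avg-const : ∀ c → avg (λ _ → c) ≡ c
  avg-const c = begin
    (1 /k) * sum {k} (λ _ → c)       ≡⟨ cong ((1 /k) *_) (sum-cong-≗ {k} λ _ → sym (*-identityˡ c)) ⟩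
    (1 /k) * sum {k} (λ _ → 1# * c)  ≡⟨ cong ((1 /k) *_) (sym (*-distribʳ-sum {k} c (λ _ → 1#))) ⟩
    (1 /k) * (sum {k} (λ _ → 1#) * c) ≡⟨ cong (λ z → (1 /k) * (z * c)) (sum-replicate k) ⟩
    (1 /k) * ((k · 1#) * c)          ≡⟨ solve-semiring 3 (λ x y z → x :* (y :* z) := y :* x :* z) refl (1 /k) (k · 1#) c ⟩
    (k · 1#) * (1 /k) * c            ≡⟨ cong (_* c) k*1/k ⟩
    1# * c                           ≡⟨ *-identityˡ c ⟩
    c                                ∎
    where open ≡-Reasoning

  -- Lists each index `i` exactly `m i` times. The number `l` of tokens is left open, since that it
  -- equals `k` comes only from the total mass.
  tokens-with-multiplicities : ∀ n (m : Fin n → ℕ) → Σ[ l ∈ ℕ ] Σ[ b ∈ (Fin l → Fin n) ]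
    (∀ f → sum (f ∘ b) ≡ ∑[ i < n ] ((m i · 1#) * f i))
  tokens-with-multiplicities zero    m = 0 , (λ ()) , λ f → refl
  tokens-with-multiplicities (suc n) m with tokens-with-multiplicities n (m ∘ suc)
  ... | l , b , sum-b = prepend (m zero)
    where
    prepend : ∀ j → Σ[ l′ ∈ ℕ ] Σ[ b′ ∈ (Fin l′ → Fin (suc n)) ]
      (∀ f → sum (f ∘ b′) ≡ (j · 1#) * f zero + ∑[ i < n ] ((m (suc i) · 1#) * f (suc i)))
    prepend zero = l , suc ∘ b , λ f → trans (sum-b (f ∘ suc))
      (sym (trans (cong₂ _+_ (zeroˡ (f zero)) refl) (+-identityˡ _)))
    prepend (suc j) with prepend j
    ... | l′ , b′ , sum-b′ = suc l′ , (zero Vector.∷ b′) , λ f → trans (cong (f zero +_) (sum-b′ f))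
      (trans (sym (+-assoc _ _ _)) (cong₂ _+_ (sym (trans (distribʳ (f zero) 1# (j · 1#)) (cong₂ _+_ (*-identityˡ _) refl))) refl))

  empirical-exists : ∀ x → ∃ λ a → Empirical a (dist x)
  empirical-exists x with tokens-with-multiplicities size (λ i → proj₁ (multiple/k x (e i)))
  ... | l , b , sum-b = relabel l≡k b sum-b
    where
    open ≡-Reasoning
    m : Fin size → ℕ
    m i = proj₁ (multiple/k x (e i))
    weight≡ : ∀ i → weight (dist x) (e i) ≡ (1 /k) * (m i · 1#)
    weight≡ i = trans (proj₂ (proj₂ (multiple/k x (e i)))) (m/k≡ (m i))
    weighted : ∀ f → ∑X (λ ρ → weight (dist x) ρ * f ρ) ≡ (1 /k) * sum (λ i → (m i · 1#) * f (e i))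
    weighted f = trans
      (sum-cong-≗ λ i → trans (cong (_* f (e i)) (weight≡ i)) (*-assoc _ _ _))
      (sym (*-distribˡ-sum (1 /k) (λ i → (m i · 1#) * f (e i))))
    -- Both sides are counted in the reals by testing with the constant 1. Characteristic zero
    -- brings the equality back to ℕ.
    l≡k : l ≡ k
    l≡k = ·1-injective (begin
      l · 1#                                           ≡⟨ sym (sum-replicate l) ⟩
      sum {l} (λ _ → 1#)                               ≡⟨ sum-b (λ _ → 1#) ⟩
      sum (λ i → (m i · 1#) * 1#)                      ≡⟨ sym (*-identityˡ _) ⟩
      1# * sum (λ i → (m i · 1#) * 1#)                 ≡⟨ cong₂ _*_ (sym k*1/k) refl ⟩
      (k · 1#) * (1 /k) * sum (λ i → (m i · 1#) * 1#)  ≡⟨ *-assoc _ _ _ ⟩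
      (k · 1#) * ((1 /k) * sum (λ i → (m i · 1#) * 1#)) ≡⟨ cong ((k · 1#) *_) (sym (weighted λ _ → 1#)) ⟩
      (k · 1#) * ∑X (λ ρ → weight (dist x) ρ * 1#)     ≡⟨ cong ((k · 1#) *_) (trans (sum-cong-≗ {size} λ i → *-identityʳ _) (total-weight (dist x))) ⟩
      (k · 1#) * 1#                                    ≡⟨ *-identityʳ _ ⟩
      k · 1#                                           ∎)
    -- Here `l` is a variable, so that the equality can be matched with `refl`.
    relabel : ∀ {l} → l ≡ k → (b : Fin l → Fin size) → (∀ f → sum (f ∘ b) ≡ sum (λ i → (m i · 1#) * f i)) →
              ∃ λ a → Empirical a (dist x)
    relabel refl b sum-b = e ∘ b , λ f → trans (weighted f) (cong ((1 /k) *_) (sym (sum-b (f ∘ e))))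

  -- Optimal transport between empirical distributions, with Kantorovich duality.

  tokenCoupling : ∀ {a b x y} → Empirical a x → Empirical b y →
                  Σ[ π ∈ Coupling x y ] transportCost π ≡ avg (λ s → d (a s) (b s))
  tokenCoupling {a} {b} {x} {y} emp-a emp-b = π , cost
    where
    open ≡-Reasoning
    π : Coupling x y
    π = record
      -- The joint law of `a s` and `b s` for a uniform seed `s`.
      { plan      = λ ρ ρ′ → avg λ s → δ (a s) ρ * δ (b s) ρ′
      ; plan≥0    = λ ρ ρ′ → avg-nonNegative λ s → *-nonNegative (indicator≥0 em) (indicator≥0 em)
      ; marginalˡ = λ ρ → begin
          ∑X (λ ρ′ → avg λ s → δ (a s) ρ * δ (b s) ρ′)  ≡⟨ sum-avg {size} _ ⟩
          avg (λ s → ∑X λ ρ′ → δ (a s) ρ * δ (b s) ρ′)  ≡⟨ (avg-cong λ s → sum-cong-≗ {size} λ i → *-comm _ _) ⟩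
          avg (λ s → ∑X λ ρ′ → δ (b s) ρ′ * δ (a s) ρ)  ≡⟨ (avg-cong λ s → ∑X-δˡ (b s) (λ _ → δ (a s) ρ)) ⟩
          avg (λ s → δ (a s) ρ)                         ≡⟨ sym (empirical-weight {x = x} emp-a ρ) ⟩
          weight x ρ                                    ∎
      ; marginalʳ = λ ρ′ → begin
          ∑X (λ ρ → avg λ s → δ (a s) ρ * δ (b s) ρ′)   ≡⟨ sum-avg {size} _ ⟩
          avg (λ s → ∑X λ ρ → δ (a s) ρ * δ (b s) ρ′)   ≡⟨ (avg-cong λ s → ∑X-δˡ (a s) (λ _ → δ (b s) ρ′)) ⟩
          avg (λ s → δ (b s) ρ′)                        ≡⟨ sym (empirical-weight {x = y} emp-b ρ′) ⟩
          weight y ρ′                                   ∎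
      }
    cost : transportCost π ≡ avg (λ s → d (a s) (b s))
    cost = begin
      ∑X (λ ρ → ∑X λ ρ′ → avg (λ s → δ (a s) ρ * δ (b s) ρ′) * d ρ ρ′)
        ≡⟨ (sum-cong-≗ {size} λ i → trans
             (sum-cong-≗ {size} λ j → trans (avg-*ʳ _ (d (e i) (e j))) (avg-cong λ s → *-assoc (δ (a s) (e i)) (δ (b s) (e j)) (d (e i) (e j))))
             (sum-avg {size} _)) ⟩
      ∑X (λ ρ → avg λ s → ∑X λ ρ′ → δ (a s) ρ * (δ (b s) ρ′ * d ρ ρ′))
        ≡⟨ (sum-cong-≗ {size} λ i → avg-cong λ s → trans
             (sym (∑X-distribˡ (δ (a s) (e i)) (λ ρ′ → δ (b s) ρ′ * d (e i) ρ′)))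
             (cong (δ (a s) (e i) *_) (∑X-δˡ (b s) (d (e i))))) ⟩
      ∑X (λ ρ → avg λ s → δ (a s) ρ * d ρ (b s))
        ≡⟨ sum-avg {size} _ ⟩
      avg (λ s → ∑X λ ρ → δ (a s) ρ * d ρ (b s))
        ≡⟨ (avg-cong λ s → ∑X-δˡ (a s) (λ ρ → d ρ (b s))) ⟩
      avg (λ s → d (a s) (b s)) ∎

  -- OT is read as the negated supremum it unfolds to: the boundedness proof inside
  -- its definition is an anonymous function that cannot be named here.
  OT-isInfimum : ∀ x y → IsInfimum (TransportCost x y) (OT x y)
  OT-isInfimum x y = -supremum-isInfimum (proj₂ (supremum _ _ _))

  OT-≤ : ∀ {a b x y} → Empirical a x → Empirical b y → OT x y ≤ avg (λ s → d (a s) (b s))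
  OT-≤ {a} {b} {x} {y} emp-a emp-b with tokenCoupling {a} {b} {x} {y} emp-a emp-b
  ... | π , cost = proj₁ (OT-isInfimum x y) (π , sym cost)

  -- Weak duality: the Lipschitz inequality is integrated against the plan, whose marginals turn the
  -- two potential terms into integrals over `y` and `x`.
  potential-duality : ∀ {x y} (v : X → ℝ) → (∀ ρ ρ′ → v ρ′ ≤ v ρ + d ρ ρ′) → (π : Coupling x y) →
    ∑X (λ ρ → weight y ρ * v ρ) ≤ ∑X (λ ρ → weight x ρ * v ρ) + transportCost π
  potential-duality {x} {y} v v-lipschitz π = begin
    ∑X (λ ρ′ → weight y ρ′ * v ρ′)
      ≡⟨ (sum-cong-≗ {size} λ j → trans (cong (_* v (e j)) (sym (marginalʳ π (e j)))) (∑X-distribʳ (v (e j)) (λ ρ → plan π ρ (e j)))) ⟩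
    ∑X (λ ρ′ → ∑X λ ρ → plan π ρ ρ′ * v ρ′)
      ≤⟨ (sum-mono-≤ {size} λ j → sum-mono-≤ {size} λ i → *-monoˡ-≤ (plan≥0 π (e i) (e j)) (v-lipschitz (e i) (e j))) ⟩
    ∑X (λ ρ′ → ∑X λ ρ → plan π ρ ρ′ * (v ρ + d ρ ρ′))
      ≡⟨ ∑-comm {size} {size} _ ⟩
    ∑X (λ ρ → ∑X λ ρ′ → plan π ρ ρ′ * (v ρ + d ρ ρ′))
      ≡⟨ (sum-cong-≗ {size} λ i → trans (sum-cong-≗ {size} λ j → distribˡ (plan π (e i) (e j)) _ _) (∑-distrib-+ {size} _ _)) ⟩
    ∑X (λ ρ → ∑X (λ ρ′ → plan π ρ ρ′ * v ρ) + ∑X (λ ρ′ → plan π ρ ρ′ * d ρ ρ′))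
      ≡⟨ ∑-distrib-+ {size} _ _ ⟩
    ∑X (λ ρ → ∑X (λ ρ′ → plan π ρ ρ′ * v ρ)) + transportCost π
      ≡⟨ cong (_+ transportCost π) (sum-cong-≗ {size} λ i → trans (sym (∑X-distribʳ (v (e i)) (plan π (e i)))) (cong (_* v (e i)) (marginalˡ π (e i)))) ⟩
    ∑X (λ ρ → weight x ρ * v ρ) + transportCost π ∎
    where open ≤-Reasoning

  -- The potential certifies optimality: it rises by at least the distance on every matched pair,
  -- and by weak duality its total rise is at most the cost of any coupling.
  OT-≥ : ∀ {a b x y} → Empirical a x → Empirical b y → (v : X → ℝ) → (∀ ρ ρ′ → v ρ′ ≤ v ρ + d ρ ρ′) →
         (∀ s → v (a s) + d (a s) (b s) ≤ v (b s)) → avg (λ s → d (a s) (b s)) ≤ OT x y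
  OT-≥ {a} {b} {x} {y} emp-a emp-b v v-lipschitz v-tight =
    proj₂ (OT-isInfimum x y) λ { (π , refl) → +-cancelʳ-≤ (avg (v ∘ a)) (bound π) }
    where
    open ≤-Reasoning
    bound : ∀ (π : Coupling x y) → avg (λ s → d (a s) (b s)) + avg (v ∘ a) ≤ transportCost π + avg (v ∘ a)
    bound π = begin
      avg (λ s → d (a s) (b s)) + avg (v ∘ a)  ≡⟨ +-comm _ _ ⟩
      avg (v ∘ a) + avg (λ s → d (a s) (b s))  ≡⟨ sym (avg-+ _ _) ⟩
      avg (λ s → v (a s) + d (a s) (b s))      ≤⟨ avg-mono v-tight ⟩
      avg (v ∘ b)                              ≡⟨ sym (emp-b v) ⟩
      ∑X (λ ρ → weight y ρ * v ρ)              ≤⟨ potential-duality v v-lipschitz π ⟩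
      ∑X (λ ρ → weight x ρ * v ρ) + transportCost π  ≡⟨ cong (_+ transportCost π) (emp-a v) ⟩
      avg (v ∘ a) + transportCost π            ≡⟨ +-comm _ _ ⟩
      transportCost π + avg (v ∘ a)            ∎

  -- Swaps of two tokens, and minima over finite sets.

  swap : (Fin k → X) → Fin k → Fin k → Fin k → X
  swap b s t = Vector.updateAt (Vector.updateAt b s (const (b t))) t (const (b s))

  swapʳ : ∀ b s t → swap b s t t ≡ b s
  swapʳ b s t = updateAt-updates t (Vector.updateAt b s (const (b t)))

  swapˡ : ∀ b {s t} → s ≢ t → swap b s t s ≡ b t
  swapˡ b {s} {t} s≢t = trans (updateAt-minimal s t _ s≢t) (updateAt-updates s b)

  swap-minimal : ∀ b {s t u} → u ≢ s → u ≢ t → swap b s t u ≡ b u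
  swap-minimal b {s} {t} {u} u≢s u≢t = trans (updateAt-minimal u t _ u≢t) (updateAt-minimal u s b u≢s)

  -- The summand may depend on the token: a constant family serves `empirical-swap`, and the
  -- distances from `a u` serve the matching cost.
  sum-swap : ∀ (h : Fin k → X → ℝ) b {s t} → s ≢ t →
    sum (λ u → h u (b u)) + (h s (b t) + h t (b s)) ≡
    sum (λ u → h u (swap b s t u)) + (h s (b s) + h t (b t))
  sum-swap h b {s} {t} s≢t = begin
    sum (λ u → h u (b u)) + (h s (b t) + h t (b s))
      ≡⟨ cong (sum (λ u → h u (b u)) +_) (cong₂ _+_ (cong (h s) (sym (swapˡ b s≢t))) (cong (h t) (sym (swapʳ b s t)))) ⟩
    sum (λ u → h u (b u)) + (h s (swap b s t s) + h t (swap b s t t))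
      ≡⟨ sum-exchange₂ (λ u → h u (b u)) (λ u → h u (swap b s t u)) s≢t
           (λ u u≢s u≢t → cong (h u) (sym (swap-minimal b u≢s u≢t))) ⟩
    sum (λ u → h u (swap b s t u)) + (h s (b s) + h t (b t)) ∎
    where open ≡-Reasoning

  empirical-swap : ∀ {b x s t} → s ≢ t → Empirical b x → Empirical (swap b s t) x
  empirical-swap {b} {x} {s} {t} s≢t emp f = trans (emp f) (cong ((1 /k) *_) (+-cancelʳ _ _ _
    (trans (cong (sum (f ∘ b) +_) (+-comm (f (b s)) (f (b t)))) (sum-swap (λ _ → f) b s≢t))))

  empirical-cong : ∀ {b b′ x} → b ≗ b′ → Empirical b x → Empirical b′ x
  empirical-cong b≗b′ emp f = trans (emp f) (avg-cong (cong f ∘ b≗b′))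

  argmin : ∀ {n} (F : Fin n → ℝ) (P : Fin n → Set) → ∃ P → ∃[ i ] P i × (∀ j → P j → F i ≤ F j)
  argmin {suc n} F P (i , Pi) with em {∃ (P ∘ suc)}
  argmin {suc n} F P (zero  , P0) | no ¬P = zero , P0 , λ { zero _ → ≤-refl ; (suc j) Pj → contradiction (j , Pj) ¬P }
  argmin {suc n} F P (suc i , Pi) | no ¬P = contradiction (i , Pi) ¬P
  argmin {suc n} F P _ | yes ∃P with argmin (F ∘ suc) (P ∘ suc) ∃P
  ... | i , Pi , min with em {P zero × F zero ≤ F (suc i)}
  ...   | yes (P0 , F0≤) = zero , P0 , λ { zero _ → ≤-refl ; (suc j) Pj → ≤-trans F0≤ (min j Pj) }
  ...   | no ¬0 = suc i , Pi , λ { zero P0 → F≤F0 P0 ; (suc j) Pj → min j Pj }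
    where
    F≤F0 : P zero → F (suc i) ≤ F zero
    F≤F0 P0 with ≤-total (F zero) (F (suc i))
    ... | inj₁ F0≤ = contradiction (P0 , F0≤) ¬0
    ... | inj₂ ≤F0 = ≤F0

  -- For loop erasure: when a walk returns to `s`, both the loop `s ∷ l₁` and the remainder `s ∷ l₂`
  -- are simple.
  unique-++⁻ : ∀ {s : Fin k} l₁ {l₂} → Unique (l₁ ++ s ∷ l₂) → Unique (s ∷ l₁) × Unique (s ∷ l₂)
  unique-++⁻ []       s∷l₂!      = ([] ∷ []) , s∷l₂!
  unique-++⁻ (t ∷ l₁) (t∉ ∷ l!) with unique-++⁻ l₁ l! | All.++⁻ l₁ t∉
  ... | (s∉l₁ ∷ l₁!) , s∷l₂! | t∉l₁ , (t≢s ∷ _) = ((t≢s ∘ sym ∷ s∉l₁) ∷ (t∉l₁ ∷ l₁!)) , s∷l₂!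

  -- Optimal matchings, and walks that use their jumps.

  module Matching (a : Fin k → X) where

    matchingCost : (Fin k → X) → ℝ
    matchingCost b = sum λ s → d (a s) (b s)

    Optimal : (Fin k → X) → 𝒫 → Set
    Optimal b y = Empirical b y × (∀ b′ → Empirical b′ y → matchingCost b ≤ matchingCost b′)

    -- Placements are coded by a finite set of size `size ^ k`. Decoding gives a placement back only
    -- pointwise, so the constraint and the cost are carried along `≗`.
    optimal-exists : ∀ {y} → ∃ (λ b → Empirical b y) → ∃ λ b → Optimal b y
    optimal-exists {y} (b₀ , emp₀) = decode (proj₁ best) , proj₁ (proj₂ best) , λ b′ emp′ →
      subst (matchingCost (decode (proj₁ best)) ≤_)
        (sum-cong-≗ λ s → cong (d (a s)) (decode-encode b′ s))
        (proj₂ (proj₂ best) (encode b′) (empirical-decode b′ emp′))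
      where
      decode : Fin (size ℕ.^ k) → Fin k → X
      decode c = e ∘ finToFun c
      encode : (Fin k → X) → Fin (size ℕ.^ k)
      encode b = funToFin (Inverse.from enumeration ∘ b)
      decode-encode : ∀ b → decode (encode b) ≗ b
      decode-encode b s = trans (cong e (finToFun-funToFin (Inverse.from enumeration ∘ b) s))
        (Inverse.strictlyInverseˡ enumeration (b s))
      empirical-decode : ∀ b → Empirical b y → Empirical (decode (encode b)) y
      empirical-decode b = empirical-cong {x = y} (sym ∘ decode-encode b)
      best : ∃[ c ] Empirical (decode c) y × (∀ c′ → Empirical (decode c′) y → matchingCost (decode c) ≤ matchingCost (decode c′))
      best = argmin (matchingCost ∘ decode) (λ c → Empirical (decode c) y) (encode b₀ , empirical-decode b₀ emp₀)

    -- A walk moves freely in X but may jump from b s back to a s, for s in the list; its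
    -- length is `walk` minus `jumps`, kept apart so that no subtraction occurs.
    walk : (Fin k → X) → X → List (Fin k) → X → ℝ
    walk b p []      y = d p y
    walk b p (s ∷ l) y = d p (b s) + walk b (a s) l y

    jumps : (Fin k → X) → List (Fin k) → ℝ
    jumps b []      = 0#
    jumps b (s ∷ l) = d (a s) (b s) + jumps b l

    walk-cong : ∀ {b b′ l} p y → All (λ s → b s ≡ b′ s) l → walk b p l y ≡ walk b′ p l y
    walk-cong p y []         = refl
    walk-cong p y (eq ∷ eqs) = cong₂ _+_ (cong (d p) eq) (walk-cong _ y eqs)

    jumps-cong : ∀ {b b′ l} → All (λ s → b s ≡ b′ s) l → jumps b l ≡ jumps b′ l
    jumps-cong []         = refl
    jumps-cong (eq ∷ eqs) = cong₂ _+_ (cong (d _) eq) (jumps-cong eqs)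

    walk-++ : ∀ b p l₁ s l₂ y → walk b p (l₁ ++ s ∷ l₂) y ≡ walk b p l₁ (b s) + walk b (a s) l₂ y
    walk-++ b p []       s l₂ y = refl
    walk-++ b p (t ∷ l₁) s l₂ y = trans (cong (d p (b t) +_) (walk-++ b (a t) l₁ s l₂ y)) (sym (+-assoc _ _ _))

    jumps-++ : ∀ b l₁ l₂ → jumps b (l₁ ++ l₂) ≡ jumps b l₁ + jumps b l₂
    jumps-++ b []       l₂ = sym (+-identityˡ _)
    jumps-++ b (s ∷ l₁) l₂ = trans (cong (d (a s) (b s) +_) (jumps-++ b l₁ l₂)) (sym (+-assoc _ _ _))

    walk-lipschitz : ∀ b p l y y′ → walk b p l y′ ≤ walk b p l y + d y y′
    walk-lipschitz b p []      y y′ = triangle p y y′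
    walk-lipschitz b p (s ∷ l) y y′ = subst (walk b p (s ∷ l) y′ ≤_) (sym (+-assoc _ _ _))
      (+-monoʳ-≤ (d p (b s)) (walk-lipschitz b (a s) l y y′))

    -- The matching obtained by shifting b′ along the cycle is reached one swap at a time,
    -- so that only the shape of b′ off the remaining list has to be tracked.
    simple-cycle : ∀ {b y} → Optimal b y → ∀ l {s b′} → Empirical b′ y → Unique (s ∷ l) →
      matchingCost b + jumps b′ (s ∷ l) ≤ matchingCost b′ + walk b′ (a s) l (b′ s)
    -- The shift is complete, and only here is the optimality of `b` invoked.
    simple-cycle {b} opt [] {s} {b′} emp _ =
      +-mono-≤ (proj₂ opt b′ emp) (≤-reflexive (+-identityʳ _))
    -- The swap puts `s` at its final place `b′ t` and leaves a shorter cycle from `t`, closing at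
    -- `b₁ t`, which is `b′ s`. The new jump `d (a t) (b′ s)` is absent from the claim, hence the
    -- cancellation.
    simple-cycle {b} {y} opt (t ∷ l) {s} {b′} emp ((s≢t ∷ s∉l) ∷ t∷l!@(t∉l ∷ _)) = +-cancelʳ-≤ (d (a t) (b′ s)) (begin
      T b + (d (a s) (b′ s) + (d (a t) (b′ t) + jumps b′ l)) + d (a t) (b′ s)
        ≡⟨ solve-semiring 5 (λ w x y z u → w :+ (x :+ (y :+ z)) :+ u := w :+ (u :+ z) :+ (x :+ y)) refl
             (T b) (d (a s) (b′ s)) (d (a t) (b′ t)) (jumps b′ l) (d (a t) (b′ s)) ⟩
      T b + (d (a t) (b′ s) + jumps b′ l) + (d (a s) (b′ s) + d (a t) (b′ t))
        ≡⟨ cong (λ z → T b + z + (d (a s) (b′ s) + d (a t) (b′ t)))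
             (cong₂ _+_ (cong (d (a t)) (sym (swapʳ b′ s t))) (jumps-cong unchanged)) ⟩
      T b + jumps b₁ (t ∷ l) + (d (a s) (b′ s) + d (a t) (b′ t))
        ≤⟨ +-monoˡ-≤ _ (simple-cycle {y = y} opt l (empirical-swap {x = y} s≢t emp) t∷l!) ⟩
      T b₁ + walk b₁ (a t) l (b₁ t) + (d (a s) (b′ s) + d (a t) (b′ t))
        ≡⟨ cong (λ z → T b₁ + z + (d (a s) (b′ s) + d (a t) (b′ t)))
             (trans (cong (walk b₁ (a t) l) (swapʳ b′ s t)) (sym (walk-cong (a t) (b′ s) unchanged))) ⟩
      T b₁ + walk b′ (a t) l (b′ s) + (d (a s) (b′ s) + d (a t) (b′ t))
        ≡⟨ solve-semiring 3 (λ x y z → x :+ y :+ z := x :+ z :+ y) refl (T b₁) (walk b′ (a t) l (b′ s)) _ ⟩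
      T b₁ + (d (a s) (b′ s) + d (a t) (b′ t)) + walk b′ (a t) l (b′ s)
        ≡⟨ cong (_+ walk b′ (a t) l (b′ s)) (sym (sum-swap (λ u → d (a u)) b′ s≢t)) ⟩
      T b′ + (d (a s) (b′ t) + d (a t) (b′ s)) + walk b′ (a t) l (b′ s)
        ≡⟨ solve-semiring 4 (λ w x y z → w :+ (x :+ y) :+ z := w :+ (x :+ z) :+ y) refl
             (T b′) (d (a s) (b′ t)) (d (a t) (b′ s)) (walk b′ (a t) l (b′ s)) ⟩
      T b′ + (d (a s) (b′ t) + walk b′ (a t) l (b′ s)) + d (a t) (b′ s) ∎)
      where
      open ≤-Reasoning
      T : (Fin k → X) → ℝ
      T = matchingCost
      b₁ : Fin k → X
      b₁ = swap b′ s t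
      unchanged : All (λ u → b′ u ≡ b₁ u) l
      unchanged = All.zipWith (λ { (s≢u , t≢u) → sym (swap-minimal b′ (s≢u ∘ sym) (t≢u ∘ sym)) }) (s∉l , t∉l)

    -- Non-negative cycles and the shortest-walk potential.

    module _ {b y} (opt : Optimal b y) where

      unique-cycle : ∀ {s l} → Unique (s ∷ l) → jumps b (s ∷ l) ≤ walk b (a s) l (b s)
      unique-cycle {s} {l} s∷l! = +-cancelʳ-≤ (matchingCost b)
        (subst₂ _≤_ (+-comm _ _) (+-comm _ _) (simple-cycle {y = y} opt l (proj₁ opt) s∷l!))

      -- The inequalities compare walk minus jumps for `l′` and `l`, with the jumps moved across. A
      -- common first edge and jump contribute equally to both.
      extend-shortcut : ∀ s t l l′ →
        (∀ z → walk b (a t) l′ z + jumps b l ≤ walk b (a t) l z + jumps b l′) →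
        (∀ z → walk b (a s) (t ∷ l′) z + jumps b (t ∷ l) ≤ walk b (a s) (t ∷ l) z + jumps b (t ∷ l′))
      extend-shortcut s t l l′ shorter z = begin
        d (a s) (b t) + walk b (a t) l′ z + (d (a t) (b t) + jumps b l)
          ≡⟨ regroup (d (a s) (b t)) (walk b (a t) l′ z) (d (a t) (b t)) (jumps b l) ⟩
        d (a s) (b t) + d (a t) (b t) + (walk b (a t) l′ z + jumps b l)
          ≤⟨ +-monoʳ-≤ _ (shorter z) ⟩
        d (a s) (b t) + d (a t) (b t) + (walk b (a t) l z + jumps b l′)
          ≡⟨ sym (regroup (d (a s) (b t)) (walk b (a t) l z) (d (a t) (b t)) (jumps b l′)) ⟩
        d (a s) (b t) + walk b (a t) l z + (d (a t) (b t) + jumps b l′) ∎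
        where
        open ≤-Reasoning
        regroup : ∀ w x y z → w + x + (y + z) ≡ w + y + (x + z)
        regroup = solve-semiring 4 (λ w x y z → w :+ x :+ (y :+ z) := w :+ y :+ (x :+ z)) refl

      -- By recursion the tail is already simple. If `s` recurs in it, the part up to that
      -- occurrence is a simple cycle, non-negative by `unique-cycle`, and dropping it does not
      -- lengthen the walk.
      erase-loops : ∀ s l → Σ[ l′ ∈ List (Fin k) ] Unique (s ∷ l′) ×
        (∀ z → walk b (a s) l′ z + jumps b l ≤ walk b (a s) l z + jumps b l′)
      erase-loops s [] = [] , ([] ∷ []) , λ z → ≤-refl
      erase-loops s (t ∷ l) with erase-loops t l
      ... | l′ , t∷l′! , shorter with em {s ∈ t ∷ l′}
      ...   | no s∉ = t ∷ l′ , (All.¬Any⇒All¬ _ s∉ ∷ t∷l′!) , extend-shortcut s t l l′ shorter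
      ...   | yes s∈ with ∈-∃++ s∈
      ...     | l₁ , l₂ , t∷l′≡ = l₂ , proj₂ split! , shortcut
        where
        open ≤-Reasoning
        split! : Unique (s ∷ l₁) × Unique (s ∷ l₂)
        split! = unique-++⁻ l₁ (subst Unique t∷l′≡ t∷l′!)
        loop : ℝ
        loop = walk b (a s) l₁ (b s)
        shortcut : ∀ z → walk b (a s) l₂ z + jumps b (t ∷ l) ≤ walk b (a s) (t ∷ l) z + jumps b l₂
        shortcut z = +-cancelʳ-≤ loop (begin
          walk b (a s) l₂ z + jumps b (t ∷ l) + loop
            ≡⟨ solve-semiring 3 (λ x y z → x :+ y :+ z := z :+ x :+ y) refl (walk b (a s) l₂ z) (jumps b (t ∷ l)) loop ⟩
          loop + walk b (a s) l₂ z + jumps b (t ∷ l)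
            ≡⟨ cong (_+ jumps b (t ∷ l)) (sym (trans (cong (λ m → walk b (a s) m z) t∷l′≡) (walk-++ b (a s) l₁ s l₂ z))) ⟩
          walk b (a s) (t ∷ l′) z + jumps b (t ∷ l)
            ≤⟨ extend-shortcut s t l l′ shorter z ⟩
          walk b (a s) (t ∷ l) z + jumps b (t ∷ l′)
            ≡⟨ cong (walk b (a s) (t ∷ l) z +_) (trans (cong (jumps b) t∷l′≡) (jumps-++ b l₁ (s ∷ l₂))) ⟩
          walk b (a s) (t ∷ l) z + (jumps b l₁ + (d (a s) (b s) + jumps b l₂))
            ≡⟨ cong (walk b (a s) (t ∷ l) z +_) (solve-semiring 3 (λ x y z → x :+ (y :+ z) := y :+ x :+ z) refl (jumps b l₁) (d (a s) (b s)) (jumps b l₂)) ⟩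
          walk b (a s) (t ∷ l) z + (jumps b (s ∷ l₁) + jumps b l₂)
            ≤⟨ +-monoʳ-≤ _ (+-monoˡ-≤ _ (unique-cycle (proj₁ split!))) ⟩
          walk b (a s) (t ∷ l) z + (loop + jumps b l₂)
            ≡⟨ solve-semiring 3 (λ x y z → x :+ (y :+ z) := x :+ z :+ y) refl (walk b (a s) (t ∷ l) z) loop (jumps b l₂) ⟩
          walk b (a s) (t ∷ l) z + jumps b l₂ + loop ∎)

      -- Loop erasure leaves the simple cycle `s ∷ l′`. Its inequality and the comparison of lengths
      -- are added, and the common terms cancel.
      cycle : ∀ s l → jumps b (s ∷ l) ≤ walk b (a s) l (b s)
      cycle s l with erase-loops s l
      ... | l′ , s∷l′! , shorter = +-cancelʳ-≤ (walk b (a s) l′ (b s) + jumps b l′) (begin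
        d (a s) (b s) + jumps b l + (walk b (a s) l′ (b s) + jumps b l′)
          ≡⟨ solve-semiring 4 (λ x y z w → x :+ y :+ (z :+ w) := x :+ w :+ (z :+ y)) refl (d (a s) (b s)) (jumps b l) (walk b (a s) l′ (b s)) (jumps b l′) ⟩
        jumps b (s ∷ l′) + (walk b (a s) l′ (b s) + jumps b l)
          ≤⟨ +-mono-≤ (unique-cycle s∷l′!) (shorter (b s)) ⟩
        walk b (a s) l′ (b s) + (walk b (a s) l (b s) + jumps b l′)
          ≡⟨ solve-semiring 3 (λ x y z → x :+ (y :+ z) := y :+ (x :+ z)) refl (walk b (a s) l′ (b s)) (walk b (a s) l (b s)) (jumps b l′) ⟩
        walk b (a s) l (b s) + (walk b (a s) l′ (b s) + jumps b l′) ∎)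
        where open ≤-Reasoning

      -- A closed walk with a first jump at `s` is a cycle through `s` with a detour via `p`, which
      -- the triangle inequality removes.
      closed-walk : ∀ p l → jumps b l ≤ walk b p l p
      closed-walk p []      = nonNegative
      closed-walk p (s ∷ l) = begin
        jumps b (s ∷ l)                   ≤⟨ cycle s l ⟩
        walk b (a s) l (b s)              ≤⟨ walk-lipschitz b (a s) l p (b s) ⟩
        walk b (a s) l p + d p (b s)      ≡⟨ +-comm _ _ ⟩
        d p (b s) + walk b (a s) l p      ∎
        where open ≤-Reasoning

      potential : X → ∃ λ (v : X → ℝ) →
        (∀ ρ ρ′ → v ρ′ ≤ v ρ + d ρ ρ′) × (∀ s → v (a s) + d (a s) (b s) ≤ v (b s))
      potential p = v , lipschitz , tight
        where
        open ≤-Reasoning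
        length : X → List (Fin k) → ℝ
        length y l = walk b p l y + - jumps b l
        -- The edge from `y` back to `p` closes the walk, and closed walks have non-negative length.
        length-bounded : ∀ y l → - d y p ≤ length y l
        length-bounded y l = x+y≤z⇒x≤z-y (subst (_≤ walk b p l y) (+-comm _ _)
          (x≤y+z⇒x-z≤y (≤-trans (closed-walk p l) (walk-lipschitz b p l y p))))
        shortest : ∀ y → Σ[ m ∈ ℝ ] (∀ l → m ≤ length y l) × (∀ {c} → (∀ l → c ≤ length y l) → c ≤ m)
        shortest y = infimum-family (length y) [] (_ , length-bounded y)
        v : X → ℝ
        v y = proj₁ (shortest y)
        v≤ : ∀ y l → v y ≤ length y l
        v≤ y = proj₁ (proj₂ (shortest y))
        v-greatest : ∀ y {c} → (∀ l → c ≤ length y l) → c ≤ v y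
        v-greatest y = proj₂ (proj₂ (shortest y))
        lipschitz : ∀ ρ ρ′ → v ρ′ ≤ v ρ + d ρ ρ′
        lipschitz ρ ρ′ = x-z≤y⇒x≤y+z (v-greatest ρ λ l → x≤y+z⇒x-z≤y (begin
          v ρ′                                      ≤⟨ v≤ ρ′ l ⟩
          walk b p l ρ′ + - jumps b l               ≤⟨ +-monoˡ-≤ _ (walk-lipschitz b p l ρ ρ′) ⟩
          walk b p l ρ + d ρ ρ′ + - jumps b l       ≡⟨ solve-semiring 3 (λ x y z → x :+ y :+ z := x :+ z :+ y) refl (walk b p l ρ) (d ρ ρ′) (- jumps b l) ⟩
          length ρ l + d ρ ρ′                       ∎))
        -- Any walk to `b s` extends by the jump of `s` to a walk to `a s`, ending with an edge of
        -- length 0. Lists may repeat seeds, so the extension is always admissible.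
        tight : ∀ s → v (a s) + d (a s) (b s) ≤ v (b s)
        tight s = v-greatest (b s) λ l → x+y≤z⇒x≤z-y (begin
          v (a s) + d (a s) (b s) + jumps b l
            ≡⟨ solve-semiring 3 (λ x y z → x :+ y :+ z := x :+ (z :+ y)) refl (v (a s)) (d (a s) (b s)) (jumps b l) ⟩
          v (a s) + (jumps b l + d (a s) (b s))
            ≡⟨ cong (v (a s) +_) (sym (trans (jumps-++ b l (s ∷ [])) (cong (jumps b l +_) (+-identityʳ _)))) ⟩
          v (a s) + jumps b (l ++ s ∷ [])
            ≤⟨ x≤z-y⇒x+y≤z (v≤ (a s) (l ++ s ∷ [])) ⟩
          walk b p (l ++ s ∷ []) (a s)
            ≡⟨ walk-++ b p l s [] (a s) ⟩
          walk b p l (b s) + d (a s) (a s)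
            ≡⟨ cong (walk b p l (b s) +_) (≈⇒0 refl) ⟩
          walk b p l (b s) + 0#
            ≡⟨ +-identityʳ _ ⟩
          walk b p l (b s) ∎)

  -- The present positions `a` are prescribed and only `b` is chosen, so that successive steps chain
  -- into one motion of the tokens.
  OT-attained : ∀ {a x} → Empirical a x → (y : 𝒫ₖ) →
    Σ[ b ∈ (Fin k → X) ] Empirical b (dist y) × OT x (dist y) ≡ avg (λ s → d (a s) (b s))
  OT-attained {a} {x} emp-a y = transport (optimal-exists {dist y} (empirical-exists y))
    where
    open Matching a
    transport : ∃ (λ b → Optimal b (dist y)) →
      Σ[ b ∈ (Fin k → X) ] Empirical b (dist y) × OT x (dist y) ≡ avg (λ s → d (a s) (b s))
    -- The position of the first token, which exists because `k` is nonzero, serves as base point of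
    -- the walks.
    transport (b , opt) = b , proj₁ opt , attained (potential {y = dist y} opt (a (fromℕ< (ℕ.>-nonZero⁻¹ k))))
      where
      attained : ∃ (λ (v : X → ℝ) → (∀ ρ ρ′ → v ρ′ ≤ v ρ + d ρ ρ′) × (∀ s → v (a s) + d (a s) (b s) ≤ v (b s))) →
        OT x (dist y) ≡ avg (λ s → d (a s) (b s))
      attained (v , lipschitz , tight) = ≤-antisym
        (OT-≤ {a} {b} {x} {dist y} emp-a (proj₁ opt)) (OT-≥ {a} {b} {x} {dist y} emp-a (proj₁ opt) v lipschitz tight)

  -- From token positions to distributions, and the comparison of costs.

  count-indicator : ∀ {n} {P : X → Set} (P? : ∀ y → Dec (P y)) (a : Fin n → X) →
    (count P? (Vec.tabulate a)) · 1# ≡ sum (λ s → indicator (P? (a s)))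
  count-indicator {zero}  P? a = refl
  count-indicator {suc n} P? a with P? (a zero)
  ... | yes _ = cong (1# +_) (count-indicator P? (a ∘ suc))
  ... | no _  = trans (count-indicator P? (a ∘ suc)) (sym (+-identityˡ _))

  empirical : (a : Fin k → X) → Σ[ x ∈ 𝒫ₖ ] Empirical a (dist x)
  empirical a = record
    { dist = record
      { weight       = w
      ; weight≥0     = λ ρ → avg-nonNegative λ s → indicator≥0 em
      ; total-weight = trans (sum-cong-≗ {size} λ i → sym (*-identityʳ _)) (trans (test λ _ → 1#) (avg-const 1#))
      }
    ; multiple/k = λ ρ → count (λ y → em {y ≡ ρ}) (Vec.tabulate a) , count≤n (λ y → em {y ≡ ρ}) (Vec.tabulate a)
        , trans (cong ((1 /k) *_) (sym (count-indicator (λ y → em {y ≡ ρ}) a))) (sym (m/k≡ (count (λ y → em {y ≡ ρ}) (Vec.tabulate a))))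
    } , test
    where
    w : X → ℝ
    w ρ = avg λ s → δ (a s) ρ
    test : ∀ f → ∑X (λ ρ → w ρ * f ρ) ≡ avg (f ∘ a)
    test f = trans (sum-cong-≗ {size} λ i → avg-*ʳ (λ s → δ (a s) (e i)) (f (e i)))
      (trans (sum-avg {size} _) (avg-cong λ s → ∑X-δˡ (a s) f))

  -- The proof stored in a refinement is irrelevant. Excluded middle decides the inequality, so it
  -- can be recomputed.
  value≥0 : (r : ℝ₊) → 0# ≤ value r
  value≥0 (_ , [ 0≤r ]) = recompute em 0≤r

  -- The service costs agree by testing `Empirical` with the cost vector, which leaves only the
  -- movement to compare with `OT`.
  randomCost-empirical : ∀ A (x : FractionalStrategy) → (∀ h → Empirical (A h) (dist (x h))) → ∀ c →
    randomCost A c ≡ series (λ t →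
      avg (λ s → d (A (applyUpTo c t) s) (A (applyUpTo c (suc t)) s))
        + ∑X λ ρ → weight (dist (x (applyUpTo c (suc t)))) ρ * value (c t ρ))
  randomCost-empirical A x emp c = trans
    (𝔼-series _ λ s t → +-nonNegative nonNegative (value≥0 (c t (A (applyUpTo c (suc t)) s))))
    (series-cong λ t → trans (avg-+ _ _) (cong (avg _ +_) (sym (emp (applyUpTo c (suc t)) (value ∘ c t)))))

  module _ (x : FractionalStrategy) where

    -- The history is most recent first, so that each step extends the previous positions.
    tokens : (h : List CostVector) → ∃ λ a → Empirical a (dist (x (reverse h)))
    tokens []      = empirical-exists (x [])
    tokens (c ∷ h) = proj₁ next , proj₁ (proj₂ next)
      where
      next : Σ[ b ∈ (Fin k → X) ] Empirical b (dist (x (reverse (c ∷ h)))) ×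
             OT (dist (x (reverse h))) (dist (x (reverse (c ∷ h)))) ≡ avg (λ s → d (proj₁ (tokens h) s) (b s))
      next = OT-attained {x = dist (x (reverse h))} (proj₂ (tokens h)) (x (reverse (c ∷ h)))

    tokens-cost : ∀ c h → OT (dist (x (reverse h))) (dist (x (reverse (c ∷ h))))
                        ≡ avg (λ s → d (proj₁ (tokens h) s) (proj₁ (tokens (c ∷ h)) s))
    tokens-cost c h = proj₂ (proj₂ (OT-attained {x = dist (x (reverse h))} (proj₂ (tokens h)) (x (reverse (c ∷ h)))))

    algorithm : RandomAlgorithm
    algorithm h = proj₁ (tokens (reverse h))

    algorithm-empirical : ∀ h → Empirical (algorithm h) (dist (x h))
    algorithm-empirical h = subst (λ g → Empirical (algorithm h) (dist (x g))) (reverse-involutive h)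
      (proj₂ (tokens (reverse h)))

    -- Extending a history at its end is a cons after reversal, which is the step described by
    -- `tokens-cost`.
    algorithm-cost : ∀ h c → OT (dist (x h)) (dist (x (h ∷ʳ c)))
                           ≡ avg (λ s → d (algorithm h s) (algorithm (h ∷ʳ c) s))
    algorithm-cost h c = begin
      OT (dist (x h)) (dist (x (h ∷ʳ c)))
        ≡⟨ cong₂ (λ g g′ → OT (dist (x g)) (dist (x g′))) (sym (reverse-involutive h))
             (trans (sym (reverse-involutive (h ∷ʳ c))) (cong reverse reverse-∷ʳ)) ⟩
      OT (dist (x (reverse (reverse h)))) (dist (x (reverse (c ∷ reverse h))))
        ≡⟨ tokens-cost c (reverse h) ⟩
      avg (λ s → d (algorithm h s) (proj₁ (tokens (c ∷ reverse h)) s))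
        ≡⟨ cong (λ g → avg λ s → d (algorithm h s) (proj₁ (tokens g) s)) (sym reverse-∷ʳ) ⟩
      avg (λ s → d (algorithm h s) (algorithm (h ∷ʳ c) s)) ∎
      where
      open ≡-Reasoning
      reverse-∷ʳ : reverse (h ∷ʳ c) ≡ c ∷ reverse h
      reverse-∷ʳ = reverse-++ h (c ∷ [])

    algorithm-randomCost : ∀ c → randomCost algorithm c ≡ fractionalCost x c
    algorithm-randomCost c = trans (randomCost-empirical algorithm x algorithm-empirical c)
      (series-cong λ t → cong₂ _+_ (sym (subst
        (λ h → OT (dist (x (applyUpTo c t))) (dist (x h)) ≡ avg (λ s → d (algorithm (applyUpTo c t) s) (algorithm h s)))
        (applyUpTo-∷ʳ c t) (algorithm-cost (applyUpTo c t) (c t)))) refl)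

  -- The motion of the tokens is one coupling among many and may cost more than `OT`, for instance
  -- when two tokens trade places, hence an inequality.
  fractionalCost-empirical : ∀ A c → fractionalCost (proj₁ ∘ empirical ∘ A) c ≤∞ randomCost A c
  fractionalCost-empirical A c = subst (fractionalCost x c ≤∞_)
    (sym (randomCost-empirical A x (λ h → proj₂ (empirical (A h))) c))
    (series-mono λ t → +-monoˡ-≤ _ (OT-≤ {x = dist (x (applyUpTo c t))} {y = dist (x (applyUpTo c (suc t)))}
      (proj₂ (empirical (A (applyUpTo c t)))) (proj₂ (empirical (A (applyUpTo c (suc t)))))))
    where
    x : FractionalStrategy
    x = proj₁ ∘ empirical ∘ A

proposition2p2 : (em : ExcludedMiddle 0ℓ) (R : Reals) (M : FiniteMetricSpace R) (k : ℕ) .{{_ : NonZero k}} →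
    let open MTS em R M k in
    ((x : FractionalStrategy) → Σ[ A ∈ RandomAlgorithm ]
    ((c : CostSequence) → randomCost A c ≡ fractionalCost x c))
    ×
    ((A : RandomAlgorithm) → Σ[ x ∈ FractionalStrategy ]
    ((c : CostSequence) → fractionalCost x c ≤∞ randomCost A c))
proposition2p2 em R M k =
    (λ x → algorithm x , algorithm-randomCost x)
  , λ A → proj₁ ∘ empirical ∘ A , fractionalCost-empirical A
  where open BarelyRandom em R M k
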